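{- For every integer $k\ge 0$, the cubic graph $T_k$ (defined in the context) has no $4$-weak bisection. That is, there is no partition of $V(T_k)$ into two disjoint sets $V_1,V_2$ with $|V_1|=|V_2|$ such that every connected component of each of the two induced subgraphs $T_k[V_1]$ and $T_k[V_2]$ is a tree on at most $2$ vertices.
   Context: Graphs are finite and simple. The graphs $L_k$, $k\ge 0$: $L_0$ is the graph obtained from the complete bipartite graph $K_{3,3}$ by removing one edge; it has exactly two vertices of degree $2$ (the endpoints of the removed edge), and all its other vertices have degree $3$. For $k\ge 1$, $L_k$ is obtained from $L_{k-1}$, whose two vertices of degree $2$ are denoted $a$ and $b$, by adding two new vertices $u,v$ and the three edges $ua$, $vb$, $uv$; thus $u$ and $v$ are the only two vertices of degree $2$ in $L_k$, and all other vertices have degree $3$. The graphs $L'_k$: for $k\ge 0$, $L'_k$ is obtained from $L_k$ by adding one new vertex adjacent to the two vertices of degree $2$ of $L_k$; this new vertex is the only vertex of degree $2$ in $L'_k$. The graphs $T_k$: for $k\ge 0$, $T_k$ is obtained from the disjoint union of one copy of $L'_k$ and two copies of $L'_0$ by adding one new vertex adjacent to the three vertices of degree $2$ (one in each copy). The graph $T_k$ is cubic. A bisection of a cubic graph $G=(V,E)$ is a partition of $V$ into two disjoint subsets $V_1,V_2$ with $|V_1|=|V_2|$. For an integer $k\ge 3$, a $k$-weak bisection of $G$ is a bisection $(V_1,V_2)$ such that every connected component of each of the two subgraphs of $G$ induced by $V_1$ and by $V_2$ is a tree on at most $k-2$ vertices. -}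

module Defs where

open import Data.Bool.Base using (Bool; true; false; not; _∧_; _∨_)
open import Data.Bool.Properties using (∧-comm; ∨-comm)
open import Data.Fin using (#_)
open import Data.Fin.Base using (Fin; zero; suc; inject₁; fromℕ; splitAt; _↑ˡ_; _↑ʳ_)
open import Data.Fin.Properties using (_≟_)
open import Data.Fin.Subset using (Subset; _∈_; ∣_∣; _∪_; _∩_; ⁅_⁆; ⊤; ⊥; inside; outside)
open import Data.Nat.Base using (ℕ; zero; suc; _+_; _∸_; _≤_; _<_)
open import Data.Product.Base using (∃; _×_)
open import Data.Sum.Base using (_⊎_; inj₁; inj₂)
open import Data.Vec.Base using (_∷_; lookup)
open import Function.Bundles using (_⇔_)
open import Relation.Binary.Construct.Closure.ReflexiveTransitive using (Star)
open import Relation.Binary.PropositionalEquality using (_≡_; refl; trans; cong; cong₂)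
open import Relation.Nullary.Decidable.Core using (⌊_⌋)
open import Relation.Nullary.Negation.Core using (¬_)

record Graph (n : ℕ) : Set where
  field
    adj        : Fin n → Fin n → Bool
    adj-sym    : ∀ x y → adj x y ≡ adj y x
    adj-irrefl : ∀ x → adj x x ≡ false

  Adj : Fin n → Fin n → Set
  Adj x y = adj x y ≡ true

open Graph public

private
  variable
    m n : ℕ

-- The elements of S in increasing order.
embed : (S : Subset n) → Fin ∣ S ∣ → Fin n
embed (inside  ∷ S) zero    = zero
embed (inside  ∷ S) (suc i) = suc (embed S i)
embed (outside ∷ S) i       = suc (embed S i)

induced : Graph n → (S : Subset n) → Graph ∣ S ∣
induced G S = record
  { adj        = λ i j → adj G (embed S i) (embed S j)
  ; adj-sym    = λ i j → adj-sym G (embed S i) (embed S j)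
  ; adj-irrefl = λ i → adj-irrefl G (embed S i)
  }

Reachable : Graph n → Fin n → Fin n → Set
Reachable G = Star (Adj G)

Connected : Graph n → Set
Connected G = ∀ x y → Reachable G x y

IsComponent : Graph n → Subset n → Set
IsComponent G C = ∃ λ x → ∀ y → (y ∈ C) ⇔ Reachable G x y

record Cycle (G : Graph n) : Set where
  field
    {excess}  : ℕ   -- the length of the cycle is 3 + excess
    vertex    : Fin (3 + excess) → Fin n
    distinct  : ∀ {i j} → vertex i ≡ vertex j → i ≡ j
    step      : ∀ i → Adj G (vertex (inject₁ i)) (vertex (suc i))
    close     : Adj G (vertex (fromℕ (2 + excess))) (vertex zero)

record IsTree {n : ℕ} (G : Graph n) : Set where
  field
    nonempty  : 0 < n
    connected : Connected G
    acyclic   : ¬ Cycle G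

record Bisection (n : ℕ) : Set where
  field
    V₁ V₂    : Subset n
    covering : V₁ ∪ V₂ ≡ ⊤
    disjoint : V₁ ∩ V₂ ≡ ⊥
    balanced : ∣ V₁ ∣ ≡ ∣ V₂ ∣

ComponentsAreTreesOfSizeAtMost : ℕ → Graph n → Set
ComponentsAreTreesOfSizeAtMost s G =
  ∀ C → IsComponent G C → IsTree (induced G C) × ∣ C ∣ ≤ s

-- Only meaningful for 3 ≤ k, because of the truncated subtraction.
record WeakBisection (k : ℕ) {n : ℕ} (G : Graph n) : Set where
  field
    bisection : Bisection n
  open Bisection bisection public
  field
    weak₁ : ComponentsAreTreesOfSizeAtMost (k ∸ 2) (induced G V₁)
    weak₂ : ComponentsAreTreesOfSizeAtMost (k ∸ 2) (induced G V₂)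

-- The new vertex is zero, with neighbourhood S; an old vertex x becomes suc x.
addVertex : Graph n → Subset n → Graph (suc n)
addVertex {n} G S = record { adj = adj′ ; adj-sym = sym′ ; adj-irrefl = irrefl′ }
  where
  adj′ : Fin (suc n) → Fin (suc n) → Bool
  adj′ zero    zero    = false
  adj′ zero    (suc y) = lookup S y
  adj′ (suc x) zero    = lookup S x
  adj′ (suc x) (suc y) = adj G x y

  sym′ : ∀ x y → adj′ x y ≡ adj′ y x
  sym′ zero    zero    = refl
  sym′ zero    (suc y) = refl
  sym′ (suc x) zero    = refl
  sym′ (suc x) (suc y) = adj-sym G x y

  irrefl′ : ∀ x → adj′ x x ≡ false
  irrefl′ zero    = refl
  irrefl′ (suc x) = adj-irrefl G x

-- The vertices of G are the x ↑ˡ n and those of H the m ↑ʳ y.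
infixr 5 _⊕_
_⊕_ : Graph m → Graph n → Graph (m + n)
_⊕_ {m} {n} G H = record
  { adj        = λ x y → adj′ (splitAt m x) (splitAt m y)
  ; adj-sym    = λ x y → sym′ (splitAt m x) (splitAt m y)
  ; adj-irrefl = λ x → irrefl′ (splitAt m x)
  }
  where
  adj′ : Fin m ⊎ Fin n → Fin m ⊎ Fin n → Bool
  adj′ (inj₁ x) (inj₁ y) = adj G x y
  adj′ (inj₂ x) (inj₂ y) = adj H x y
  adj′ (inj₁ _) (inj₂ _) = false
  adj′ (inj₂ _) (inj₁ _) = false

  sym′ : ∀ x y → adj′ x y ≡ adj′ y x
  sym′ (inj₁ x) (inj₁ y) = adj-sym G x y
  sym′ (inj₂ x) (inj₂ y) = adj-sym H x y
  sym′ (inj₁ _) (inj₂ _) = refl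
  sym′ (inj₂ _) (inj₁ _) = refl

  irrefl′ : ∀ x → adj′ x x ≡ false
  irrefl′ (inj₁ x) = adj-irrefl G x
  irrefl′ (inj₂ x) = adj-irrefl H x

completeBipartite : ∀ m n → Graph (m + n)
completeBipartite m n = record
  { adj        = λ x y → adj′ (splitAt m x) (splitAt m y)
  ; adj-sym    = λ x y → sym′ (splitAt m x) (splitAt m y)
  ; adj-irrefl = λ x → irrefl′ (splitAt m x)
  }
  where
  adj′ : Fin m ⊎ Fin n → Fin m ⊎ Fin n → Bool
  adj′ (inj₁ _) (inj₁ _) = false
  adj′ (inj₂ _) (inj₂ _) = false
  adj′ (inj₁ _) (inj₂ _) = true
  adj′ (inj₂ _) (inj₁ _) = true

  sym′ : ∀ x y → adj′ x y ≡ adj′ y x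
  sym′ (inj₁ _) (inj₁ _) = refl
  sym′ (inj₂ _) (inj₂ _) = refl
  sym′ (inj₁ _) (inj₂ _) = refl
  sym′ (inj₂ _) (inj₁ _) = refl

  irrefl′ : ∀ x → adj′ x x ≡ false
  irrefl′ (inj₁ _) = refl
  irrefl′ (inj₂ _) = refl

removeEdge : Graph n → Fin n → Fin n → Graph n
removeEdge {n} G p q = record
  { adj        = λ x y → adj G x y ∧ not (removed x y)
  ; adj-sym    = λ x y → cong₂ (λ e r → e ∧ not r) (adj-sym G x y) (removed-sym x y)
  ; adj-irrefl = λ x → cong (_∧ not (removed x x)) (adj-irrefl G x)
  }
  where
  removed : Fin n → Fin n → Bool
  removed x y = (⌊ x ≟ p ⌋ ∧ ⌊ y ≟ q ⌋) ∨ (⌊ x ≟ q ⌋ ∧ ⌊ y ≟ p ⌋)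

  removed-sym : ∀ x y → removed x y ≡ removed y x
  removed-sym x y = trans
    (∨-comm (⌊ x ≟ p ⌋ ∧ ⌊ y ≟ q ⌋) _)
    (cong₂ _∨_ (∧-comm ⌊ x ≟ q ⌋ _) (∧-comm ⌊ x ≟ p ⌋ _))

order-L : ℕ → ℕ
order-L zero    = 6
order-L (suc k) = 2 + order-L k

-- The two vertices of degree 2 of L k.
a b : ∀ k → Fin (order-L k)
a zero    = # 0
a (suc k) = suc zero
b zero    = # 3
b (suc k) = zero

-- In the step, u is added first, joined to a; then v, joined to u and b.
-- So u ends up as suc zero and v as zero.
L : ∀ k → Graph (order-L k)
L zero    = removeEdge (completeBipartite 3 3) (# 0) (# 3)
L (suc k) = addVertex (addVertex (L k) ⁅ a k ⁆) (⁅ zero ⁆ ∪ ⁅ suc (b k) ⁆)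

order-L′ : ℕ → ℕ
order-L′ k = suc (order-L k)

L′ : ∀ k → Graph (order-L′ k)
L′ k = addVertex (L k) (⁅ a k ⁆ ∪ ⁅ b k ⁆)

-- The vertex of degree 2 of L′ k.
c : ∀ k → Fin (order-L′ k)
c k = zero

order-T : ℕ → ℕ
order-T k = suc (order-L′ k + (order-L′ 0 + order-L′ 0))

T : ∀ k → Graph (order-T k)
T k = addVertex (L′ k ⊕ L′ 0 ⊕ L′ 0)
  (  ⁅ c k ↑ˡ (order-L′ 0 + order-L′ 0) ⁆
   ∪ ⁅ order-L′ k ↑ʳ (c 0 ↑ˡ order-L′ 0) ⁆
   ∪ ⁅ order-L′ k ↑ʳ (order-L′ 0 ↑ʳ c 0) ⁆ )

{-# OPTIONS --safe #-}
-- Colour the vertices by the two sides of a 4-weak bisection: no vertex has two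
-- neighbours of its own colour.  In L k this forces opposite colours on a k and b k
-- and equally many vertices of each colour: for L 0 by checking all 64 colourings,
-- then by induction on k.  So in L′ k the vertex c k already has a neighbour of its
-- own colour, and the centre of T k must be coloured opposite to its three
-- neighbours: the colour classes of T k differ by 3 − 1 = 2 vertices.
module Submission where

open import Defs
open import Data.Bool.Base using (Bool; true; false; not)
open import Data.Bool.Properties using (¬-not)
import Data.Bool.Properties as Bool
open import Data.Fin.Base using (Fin; zero; suc; _↑ˡ_; _↑ʳ_)
open import Data.Fin.Properties
  using (_≟_; all?; sequence; suc-injective; ↑ˡ-injective; ↑ʳ-injective; splitAt-↑ˡ; splitAt-↑ʳ)
open import Data.Fin.Subset using (Subset; _∈_; ∣_∣; ∁; _-_; _∪_; ⁅_⁆; inside; outside)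
open import Data.Fin.Subset.Properties
  using ( ⊆-antisym; ∈⊤; ∉⊥; x∈p∩q⁺; x∈p∪q⁺; x∈p∪q⁻; x∈⁅x⁆; x∉p⇒x∈∁p; x∈∁p⇒x∉p
        ; x∈p∧x≢y⇒x∈p-y; x∈p⇒∣p-x∣<∣p∣; anySubset?)
open import Data.Nat.Base using (ℕ; zero; suc; _+_; _≤_; z≤n)
open import Data.Nat.Properties using (≤-<-trans; m≢1+n+m; +-suc; <⇒≱)
import Data.Nat.Properties as ℕ
open import Data.Product.Base using (∃; _×_; _,_; proj₁; proj₂; uncurry)
open import Data.Sum.Base using (_⊎_; inj₁; inj₂)
open import Data.Vec.Base using ([]; _∷_; _++_; lookup; tabulate; splitAt; here; there)
open import Data.Vec.Properties
  using (lookup-++ˡ; lookup-++ʳ; lookup∘tabulate; []=⇒lookup; lookup⇒[]=; map-++)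
open import Effect.Monad using (RawMonad)
open import Function.Base using (_∘_; case_of_)
open import Function.Bundles using (mk⇔)
open import Relation.Binary.Construct.Closure.ReflexiveTransitive using (ε; _◅_)
open import Relation.Binary.PropositionalEquality
  using (_≡_; _≢_; refl; sym; trans; cong; subst)
open import Relation.Nullary.Decidable
  using (Dec; yes; no; does; dec-true; ¬?; _×-dec_; _→-dec_; ¬¬-excluded-middle; decidable-stable; from-no)
open import Relation.Nullary.Negation using (¬_; contradiction; ¬¬-Monad)

private
  variable
    m n : ℕ

-- Subsets: enumeration and cardinality.

embed-surjective : ∀ (S : Subset n) {x} → x ∈ S → ∃ λ i → embed S i ≡ x
embed-surjective (inside  ∷ S) here        = zero , refl
embed-surjective (inside  ∷ S) (there x∈S) with i , refl ← embed-surjective S x∈S = suc i , refl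
embed-surjective (outside ∷ S) (there x∈S) with i , refl ← embed-surjective S x∈S = i , refl

-- Deleting `z` and then `y` shrinks the set strictly each time and still leaves `x`. This
-- contradicts the bound 2 on a component that contains a vertex and two of its neighbours.
3≤∣p∣ : ∀ {p : Subset n} {x y z} → x ∈ p → y ∈ p → z ∈ p → x ≢ y → x ≢ z → y ≢ z → 3 ≤ ∣ p ∣
3≤∣p∣ {p = p} {x} {y} {z} x∈p y∈p z∈p x≢y x≢z y≢z =
  ≤-<-trans (≤-<-trans (≤-<-trans z≤n
    (x∈p⇒∣p-x∣<∣p∣ x∈p-z-y)) (x∈p⇒∣p-x∣<∣p∣ y∈p-z)) (x∈p⇒∣p-x∣<∣p∣ z∈p)
  where
  y∈p-z : y ∈ p - z
  y∈p-z = x∈p∧x≢y⇒x∈p-y y∈p y≢z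

  x∈p-z-y : x ∈ p - z - y
  x∈p-z-y = x∈p∧x≢y⇒x∈p-y (x∈p∧x≢y⇒x∈p-y x∈p x≢z) x≢y

∣p++q∣≡∣p∣+∣q∣ : ∀ (p : Subset m) (q : Subset n) → ∣ p ++ q ∣ ≡ ∣ p ∣ + ∣ q ∣
∣p++q∣≡∣p∣+∣q∣ []            q = refl
∣p++q∣≡∣p∣+∣q∣ (inside  ∷ p) q = cong suc (∣p++q∣≡∣p∣+∣q∣ p q)
∣p++q∣≡∣p∣+∣q∣ (outside ∷ p) q = ∣p++q∣≡∣p∣+∣q∣ p q

-- Neighbours inside small components.

Adj⇒≢ : ∀ (G : Graph n) {x y} → Adj G x y → x ≢ y
Adj⇒≢ G {x} xy refl = case trans (sym xy) (adj-irrefl G x) of λ ()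

-- Reachability is only decided up to double negation, which suffices because the
-- conclusion is stable.
neighbour-unique : ∀ (G : Graph n) → ComponentsAreTreesOfSizeAtMost 2 G →
                   ∀ {x y z} → Adj G x y → Adj G x z → y ≡ z
neighbour-unique G small {x} {y} {z} xy xz = decidable-stable (y ≟ z) λ y≢z →
  sequence (RawMonad.rawApplicative ¬¬-Monad) (λ w → ¬¬-excluded-middle {A = Reachable G x w}) λ reach? →
  let C = tabulate (λ w → does (reach? w))
      into : ∀ {w} → Reachable G x w → w ∈ C
      into {w} r = lookup⇒[]= w C (trans (lookup∘tabulate _ w) (dec-true (reach? w) r))
      outof : ∀ {w} → w ∈ C → Reachable G x w
      outof {w} w∈C = does⇒ (reach? w) (trans (sym (lookup∘tabulate _ w)) ([]=⇒lookup w∈C))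
      ∣C∣≤2 = proj₂ (small C (x , λ w → mk⇔ outof into))
  in <⇒≱ (3≤∣p∣ (into ε) (into (xy ◅ ε)) (into (xz ◅ ε)) (Adj⇒≢ G xy) (Adj⇒≢ G xz) y≢z) ∣C∣≤2
  where
  does⇒ : ∀ {A : Set} (A? : Dec A) → does A? ≡ true → A
  does⇒ (yes a) _ = a

neighbour-unique-within : ∀ (G : Graph n) S → ComponentsAreTreesOfSizeAtMost 2 (induced G S) →
                          ∀ {x y z} → x ∈ S → y ∈ S → z ∈ S → Adj G x y → Adj G x z → y ≡ z
neighbour-unique-within G S small x∈S y∈S z∈S xy xz
  -- Replacing the three vertices by images under `embed S` turns `xy` and `xz` into adjacencies of
  -- `induced G S` by definition.
  with _ , refl ← embed-surjective S x∈S
     | _ , refl ← embed-surjective S y∈S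
     | _ , refl ← embed-surjective S z∈S
  = cong (embed S) (neighbour-unique (induced G S) small xy xz)

-- Bisections as cherry-free colourings.

-- The subset is read as a 2-colouring, so one condition covers both classes: no path on three
-- vertices is monochromatic.
CherryFree : Graph n → Subset n → Set
CherryFree G S = ∀ x y z → Adj G x y → Adj G x z →
                 lookup S x ≡ lookup S y → lookup S x ≡ lookup S z → y ≡ z

V₂≡∁V₁ : (B : Bisection n) → Bisection.V₂ B ≡ ∁ (Bisection.V₁ B)
V₂≡∁V₁ B = ⊆-antisym
  (λ {x} x∈V₂ → x∉p⇒x∈∁p λ x∈V₁ → ∉⊥ (subst (x ∈_) disjoint (x∈p∩q⁺ (x∈V₁ , x∈V₂))))
  (λ {x} x∈∁V₁ → case x∈p∪q⁻ V₁ V₂ (subst (x ∈_) (sym covering) ∈⊤) of λ where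
    (inj₁ x∈V₁) → contradiction x∈V₁ (x∈∁p⇒x∉p x∈∁V₁)
    (inj₂ x∈V₂) → x∈V₂)
  where open Bisection B

-- Three vertices of one colour lie together in `V₁` or together in `V₂`, and within either class a
-- vertex has at most one neighbour.
weakBisection⇒cherryFree : ∀ (G : Graph n) (W : WeakBisection 4 G) → CherryFree G (WeakBisection.V₁ W)
weakBisection⇒cherryFree G W x y z xy xz x≡y x≡z = go (lookup V₁ x) refl
  where
  open WeakBisection W

  ∈V₁ : ∀ {w} → lookup V₁ w ≡ true → w ∈ V₁
  ∈V₁ = lookup⇒[]= _ V₁

  ∈V₂ : ∀ {w} → lookup V₁ w ≡ false → w ∈ V₂
  ∈V₂ w≡false = subst (_ ∈_) (sym (V₂≡∁V₁ bisection))
    (x∉p⇒x∈∁p λ w∈V₁ → case trans (sym w≡false) ([]=⇒lookup w∈V₁) of λ ())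

  go : ∀ colour → lookup V₁ x ≡ colour → y ≡ z
  go true  eq = neighbour-unique-within G V₁ weak₁
    (∈V₁ eq) (∈V₁ (trans (sym x≡y) eq)) (∈V₁ (trans (sym x≡z) eq)) xy xz
  go false eq = neighbour-unique-within G V₂ weak₂
    (∈V₂ eq) (∈V₂ (trans (sym x≡y) eq)) (∈V₂ (trans (sym x≡z) eq)) xy xz

cherryFree? : ∀ (G : Graph n) S → Dec (CherryFree G S)
cherryFree? G S = all? λ x → all? λ y → all? λ z →
  (adj G x y Bool.≟ true) →-dec (adj G x z Bool.≟ true) →-dec
  (lookup S x Bool.≟ lookup S y) →-dec (lookup S x Bool.≟ lookup S z) →-dec (y ≟ z)

-- Restriction of colourings to subgraphs.

cherryFree-addVertex⁻ : ∀ (G : Graph n) N s S → CherryFree (addVertex G N) (s ∷ S) → CherryFree G S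
cherryFree-addVertex⁻ G N s S free x y z xy xz x≡y x≡z =
  suc-injective (free (suc x) (suc y) (suc z) xy xz x≡y x≡z)

adj-⊕ˡ : ∀ (G : Graph m) (H : Graph n) {x y} → Adj G x y → Adj (G ⊕ H) (x ↑ˡ n) (y ↑ˡ n)
adj-⊕ˡ {m} {n} G H {x} {y} xy rewrite splitAt-↑ˡ m x n | splitAt-↑ˡ m y n = xy

adj-⊕ʳ : ∀ (G : Graph m) (H : Graph n) {x y} → Adj H x y → Adj (G ⊕ H) (m ↑ʳ x) (m ↑ʳ y)
adj-⊕ʳ {m} {n} G H {x} {y} xy rewrite splitAt-↑ʳ m n x | splitAt-↑ʳ m n y = xy

≡-++ˡ : ∀ (P : Subset m) (Q : Subset n) {x y} → lookup P x ≡ lookup P y →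
        lookup (P ++ Q) (x ↑ˡ n) ≡ lookup (P ++ Q) (y ↑ˡ n)
≡-++ˡ P Q {x} {y} eq = trans (lookup-++ˡ P Q x) (trans eq (sym (lookup-++ˡ P Q y)))

≡-++ʳ : ∀ (P : Subset m) (Q : Subset n) {x y} → lookup Q x ≡ lookup Q y →
        lookup (P ++ Q) (m ↑ʳ x) ≡ lookup (P ++ Q) (m ↑ʳ y)
≡-++ʳ P Q {x} {y} eq = trans (lookup-++ʳ P Q x) (trans eq (sym (lookup-++ʳ P Q y)))

cherryFree-⊕⁻ˡ : ∀ (G : Graph m) (H : Graph n) P Q → CherryFree (G ⊕ H) (P ++ Q) → CherryFree G P
cherryFree-⊕⁻ˡ G H P Q free x y z xy xz x≡y x≡z = ↑ˡ-injective _ y z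
  (free _ _ _ (adj-⊕ˡ G H xy) (adj-⊕ˡ G H xz) (≡-++ˡ P Q x≡y) (≡-++ˡ P Q x≡z))

cherryFree-⊕⁻ʳ : ∀ (G : Graph m) (H : Graph n) P Q → CherryFree (G ⊕ H) (P ++ Q) → CherryFree H Q
cherryFree-⊕⁻ʳ G H P Q free x y z xy xz x≡y x≡z = ↑ʳ-injective _ y z
  (free _ _ _ (adj-⊕ʳ G H xy) (adj-⊕ʳ G H xz) (≡-++ʳ P Q x≡y) (≡-++ʳ P Q x≡z))

-- Colourings of the graphs `L k` and `L′ k`.

Balanced : Subset n → Set
Balanced S = ∣ S ∣ ≡ ∣ ∁ S ∣

≡-or-≡ : ∀ {s t : Bool} → s ≢ t → ∀ r → r ≡ s ⊎ r ≡ t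
≡-or-≡ {s} {t} s≢t r with r Bool.≟ t
... | yes r≡t = inj₂ r≡t
... | no  r≢t = inj₁ (trans (¬-not r≢t) (sym (¬-not s≢t)))

balanced-∷∷ : ∀ {s t} (S : Subset n) → s ≢ t → Balanced S → Balanced (s ∷ t ∷ S)
balanced-∷∷ {s = true}  {true}  S s≢t _   = contradiction refl s≢t
balanced-∷∷ {s = true}  {false} S s≢t bal = cong suc bal
balanced-∷∷ {s = false} {true}  S s≢t bal = cong suc bal
balanced-∷∷ {s = false} {false} S s≢t _   = contradiction refl s≢t

-- The colour difference drives the induction on `k` and later gives `c k` a neighbour of its own
-- colour; the balance serves the final count.
Forced : ∀ k → Subset (order-L k) → Set
Forced k S = lookup S (a k) ≢ lookup S (b k) × Balanced S

forced? : ∀ k S → Dec (Forced k S)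
forced? k S = ¬? (lookup S (a k) Bool.≟ lookup S (b k)) ×-dec (∣ S ∣ ℕ.≟ ∣ ∁ S ∣)

L₀-forced : ∀ S → CherryFree (L 0) S → Forced 0 S
-- The claim is recast as the absence of a counterexample among all subsets, which `anySubset?`
-- decides by evaluation.
L₀-forced S free = decidable-stable (forced? 0 S) λ ¬forced →
  from-no (anySubset? λ S → cherryFree? (L 0) S ×-dec ¬? (forced? 0 S)) (S , free , ¬forced)

-- If `u` and `v` had one colour, it would be that of `a k` or of `b k`, since these differ. Then
-- `u` would be the middle of a monochromatic path from `v` to `a k`, or `v` of one from `u` to
-- `b k`. So the two new vertices differ in colour and preserve the balance.
L-forced : ∀ k S → CherryFree (L k) S → Forced k S
L-forced zero    S           free = L₀-forced S free
L-forced (suc k) (v ∷ u ∷ S) free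
  with a≢b , bal ← L-forced k S (cherryFree-addVertex⁻ (L k) _ u S
                              (cherryFree-addVertex⁻ (addVertex (L k) _) _ v (u ∷ S) free))
  = u≢v , balanced-∷∷ S (u≢v ∘ sym) bal
  where
  u≢v : u ≢ v
  u≢v u≡v with ≡-or-≡ a≢b u
  ... | inj₁ u≡a = case free (suc zero) zero (suc (suc (a k))) refl ([]=⇒lookup (x∈⁅x⁆ (a k))) u≡v u≡a of λ ()
  ... | inj₂ u≡b = case free zero (suc zero) (suc (suc (b k))) refl
                          ([]=⇒lookup (x∈p∪q⁺ {p = ⁅ zero ⁆} (inj₂ (x∈⁅x⁆ (suc (b k))))))
                          (sym u≡v) (trans (sym u≡v) u≡b) of λ ()

L′-forced : ∀ k s S → CherryFree (L′ k) (s ∷ S) → Forced k S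
L′-forced k s S free = L-forced k S (cherryFree-addVertex⁻ (L k) (⁅ a k ⁆ ∪ ⁅ b k ⁆) s S free)

-- The centre of `T k` and its three neighbours.

-- A twin uses up the one neighbour of its own colour that a cherry-free colouring allows a vertex,
-- so any further neighbour gets the opposite colour.
HasTwin : Graph n → Subset n → Fin n → Set
HasTwin G S x = ∃ λ w → Adj G x w × lookup S x ≡ lookup S w

-- The two neighbours `a k` and `b k` carry both colours, so one of them matches `c k`.
c-has-twin : ∀ k S → CherryFree (L′ k) S → HasTwin (L′ k) S (c k)
c-has-twin k (s ∷ S) free
  with ≡-or-≡ (proj₁ (L′-forced k s S free)) s
... | inj₁ s≡a = suc (a k) , []=⇒lookup (x∈p∪q⁺ (inj₁ (x∈⁅x⁆ (a k)))) , s≡a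
... | inj₂ s≡b = suc (b k) , []=⇒lookup (x∈p∪q⁺ {p = ⁅ a k ⁆} (inj₂ (x∈⁅x⁆ (b k)))) , s≡b

hasTwin-⊕ˡ : ∀ (G : Graph m) (H : Graph n) P Q {x} → HasTwin G P x → HasTwin (G ⊕ H) (P ++ Q) (x ↑ˡ n)
hasTwin-⊕ˡ {n = n} G H P Q (w , xw , x≡w) = w ↑ˡ n , adj-⊕ˡ G H xw , ≡-++ˡ P Q x≡w

hasTwin-⊕ʳ : ∀ (G : Graph m) (H : Graph n) P Q {x} → HasTwin H Q x → HasTwin (G ⊕ H) (P ++ Q) (m ↑ʳ x)
hasTwin-⊕ʳ {m = m} G H P Q (w , xw , x≡w) = m ↑ʳ w , adj-⊕ʳ G H xw , ≡-++ʳ P Q x≡w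

new-vertex-opposite : ∀ (G : Graph n) N {t} S {x} → CherryFree (addVertex G N) (t ∷ S) →
                      x ∈ N → HasTwin G S x → lookup S x ≡ not t
new-vertex-opposite G N S free x∈N (w , xw , x≡w) = ¬-not λ x≡t →
  -- If `x` had the colour of the new vertex, `x` would be the middle of a monochromatic path from
  -- the new vertex to the twin.
  case free (suc _) zero (suc w) ([]=⇒lookup x∈N) xw x≡t x≡w of λ ()

-- Each of `x`, `y`, `z` has a twin within its own summand, and the twin persists in the disjoint
-- union, so `new-vertex-opposite` applies to all three.
hub-opposite : ∀ {l} (F : Graph l) (G : Graph m) (H : Graph n) x y z {t} P Q R →
  CherryFree (addVertex (F ⊕ G ⊕ H) (⁅ x ↑ˡ (m + n) ⁆ ∪ ⁅ l ↑ʳ (y ↑ˡ n) ⁆ ∪ ⁅ l ↑ʳ (m ↑ʳ z) ⁆))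
             (t ∷ (P ++ (Q ++ R))) →
  HasTwin F P x → HasTwin G Q y → HasTwin H R z →
  lookup P x ≡ not t × lookup Q y ≡ not t × lookup R z ≡ not t
hub-opposite {m} {n} {l} F G H x y z {t} P Q R free twin-x twin-y twin-z = x≡not-t , y≡not-t , z≡not-t
  where
  x′ = x ↑ˡ (m + n)
  y′ = l ↑ʳ (y ↑ˡ n)
  z′ = l ↑ʳ (m ↑ʳ z)

  opposite : ∀ {v} → v ∈ ⁅ x′ ⁆ ∪ ⁅ y′ ⁆ ∪ ⁅ z′ ⁆ → HasTwin (F ⊕ G ⊕ H) (P ++ (Q ++ R)) v →
             lookup (P ++ (Q ++ R)) v ≡ not t
  opposite = new-vertex-opposite (F ⊕ G ⊕ H) _ (P ++ (Q ++ R)) free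

  x≡not-t : lookup P x ≡ not t
  x≡not-t = trans (sym (lookup-++ˡ P (Q ++ R) x))
    (opposite (x∈p∪q⁺ (inj₁ (x∈⁅x⁆ x′))) (hasTwin-⊕ˡ F (G ⊕ H) P (Q ++ R) twin-x))

  y≡not-t : lookup Q y ≡ not t
  y≡not-t = trans (sym (trans (lookup-++ʳ P (Q ++ R) (y ↑ˡ n)) (lookup-++ˡ Q R y)))
    (opposite (x∈p∪q⁺ {p = ⁅ x′ ⁆} (inj₂ (x∈p∪q⁺ (inj₁ (x∈⁅x⁆ y′)))))
      (hasTwin-⊕ʳ F (G ⊕ H) P (Q ++ R) (hasTwin-⊕ˡ G H Q R twin-y)))

  z≡not-t : lookup R z ≡ not t
  z≡not-t = trans (sym (trans (lookup-++ʳ P (Q ++ R) (m ↑ʳ z)) (lookup-++ʳ Q R z)))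
    (opposite (x∈p∪q⁺ {p = ⁅ x′ ⁆} (inj₂ (x∈p∪q⁺ {p = ⁅ y′ ⁆} (inj₂ (x∈⁅x⁆ z′)))))
      (hasTwin-⊕ʳ F (G ⊕ H) P (Q ++ R) (hasTwin-⊕ʳ G H Q R twin-z)))

-- Counting the colour classes of `T k`.

split₃ : ∀ l m (S : Subset (l + (m + n))) →
         ∃ λ (P : Subset l) → ∃ λ (Q : Subset m) → ∃ λ (R : Subset n) → S ≡ P ++ (Q ++ R)
split₃ l m S
  with P , S′ , refl ← splitAt l S
  with Q , R , refl ← splitAt m S′
  = P , Q , R , refl

∣p++q++r∣ : ∀ {o} (p : Subset m) (q : Subset n) (r : Subset o) →
            ∣ p ++ (q ++ r) ∣ ≡ ∣ p ∣ + (∣ q ∣ + ∣ r ∣)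
∣p++q++r∣ p q r = trans (∣p++q∣≡∣p∣+∣q∣ p (q ++ r)) (cong (∣ p ∣ +_) (∣p++q∣≡∣p∣+∣q∣ q r))

∁-++-++ : ∀ {o} (p : Subset m) (q : Subset n) (r : Subset o) →
          ∁ (p ++ (q ++ r)) ≡ ∁ p ++ (∁ q ++ ∁ r)
∁-++-++ p q r = trans (map-++ not p (q ++ r)) (cong (∁ p ++_) (map-++ not q r))

-- The blocks `P`, `Q`, `R` contribute equally to both classes; of the remaining four vertices one
-- has colour `t` and three have colour `not t`.
opposite-copies-unbalanced : ∀ {o t p q r} (P : Subset m) (Q : Subset n) (R : Subset o) →
  p ≡ not t × q ≡ not t × r ≡ not t →
  Balanced P × Balanced Q × Balanced R →
  ¬ Balanced (t ∷ ((p ∷ P) ++ ((q ∷ Q) ++ (r ∷ R))))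
opposite-copies-unbalanced {t = t} P Q R (refl , refl , refl) (balP , balQ , balR) bal =
  impossible t (trans bal (cong (λ S → ∣ not t ∷ S ∣) (∁-++-++ (not t ∷ P) (not t ∷ Q) (not t ∷ R))))
  where
  1+sum≢sum-1+ : ∀ p q r → suc (p + (q + r)) ≢ suc p + (suc q + suc r)
  1+sum≢sum-1+ p q r eq
    rewrite +-suc q r | +-suc p (suc (q + r)) | +-suc p (q + r)
    -- After the rewriting the right side exceeds the left by 2, that is, by `1 + n` with `n = 1`.
    = m≢1+n+m (suc (p + (q + r))) {1} eq

  impossible : ∀ t → ∣ t ∷ ((not t ∷ P) ++ ((not t ∷ Q) ++ (not t ∷ R))) ∣ ≢
                     ∣ not t ∷ (∁ (not t ∷ P) ++ (∁ (not t ∷ Q) ++ ∁ (not t ∷ R))) ∣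
  impossible true eq
    rewrite ∣p++q++r∣ (false ∷ P) (false ∷ Q) (false ∷ R)
          | ∣p++q++r∣ (true ∷ ∁ P) (true ∷ ∁ Q) (true ∷ ∁ R)
          | sym balP | sym balQ | sym balR
    = 1+sum≢sum-1+ (∣ P ∣) (∣ Q ∣) (∣ R ∣) eq
  impossible false eq
    rewrite ∣p++q++r∣ (true ∷ P) (true ∷ Q) (true ∷ R)
          | ∣p++q++r∣ (false ∷ ∁ P) (false ∷ ∁ Q) (false ∷ ∁ R)
          | sym balP | sym balQ | sym balR
    -- Here the centre lies outside the subset, so the larger class is on the left.
    = 1+sum≢sum-1+ (∣ P ∣) (∣ Q ∣) (∣ R ∣) (sym eq)

-- The colouring restricts to a cherry-free one on each copy of `L′`, which yields both the twin of
-- its `c` and the balance of its `L`.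
T-forced : ∀ k {t p q r} (P : Subset (order-L k)) (Q R : Subset (order-L 0)) →
           CherryFree (T k) (t ∷ ((p ∷ P) ++ ((q ∷ Q) ++ (r ∷ R)))) →
           (p ≡ not t × q ≡ not t × r ≡ not t) × (Balanced P × Balanced Q × Balanced R)
T-forced k {p = p} {q} {r} P Q R free =
    hub-opposite (L′ k) (L′ 0) (L′ 0) (c k) (c 0) (c 0) (p ∷ P) (q ∷ Q) (r ∷ R) free
      (c-has-twin k (p ∷ P) freeP) (c-has-twin 0 (q ∷ Q) freeQ) (c-has-twin 0 (r ∷ R) freeR)
  , proj₂ (L′-forced k p P freeP) , proj₂ (L′-forced 0 q Q freeQ) , proj₂ (L′-forced 0 r R freeR)
  where
  free-⊕ : CherryFree (L′ k ⊕ L′ 0 ⊕ L′ 0) ((p ∷ P) ++ ((q ∷ Q) ++ (r ∷ R)))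
  free-⊕ = cherryFree-addVertex⁻ (L′ k ⊕ L′ 0 ⊕ L′ 0) _ _ _ free

  freeP : CherryFree (L′ k) (p ∷ P)
  freeP = cherryFree-⊕⁻ˡ (L′ k) (L′ 0 ⊕ L′ 0) (p ∷ P) ((q ∷ Q) ++ (r ∷ R)) free-⊕

  freeQR : CherryFree (L′ 0 ⊕ L′ 0) ((q ∷ Q) ++ (r ∷ R))
  freeQR = cherryFree-⊕⁻ʳ (L′ k) (L′ 0 ⊕ L′ 0) (p ∷ P) ((q ∷ Q) ++ (r ∷ R)) free-⊕

  freeQ : CherryFree (L′ 0) (q ∷ Q)
  freeQ = cherryFree-⊕⁻ˡ (L′ 0) (L′ 0) (q ∷ Q) (r ∷ R) freeQR

  freeR : CherryFree (L′ 0) (r ∷ R)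
  freeR = cherryFree-⊕⁻ʳ (L′ 0) (L′ 0) (q ∷ Q) (r ∷ R) freeQR

T-unbalanced : ∀ k S → CherryFree (T k) S → ¬ Balanced S
T-unbalanced k (t ∷ S) = go (split₃ (order-L′ k) (order-L′ 0) S)
  where
  go : ∀ {S} → (∃ λ P → ∃ λ Q → ∃ λ R → S ≡ P ++ (Q ++ R)) →
       CherryFree (T k) (t ∷ S) → ¬ Balanced (t ∷ S)
  -- The head of each block is the colour of the vertex `c` of that copy; the tail colours the copy
  -- of `L`.
  go ((_ ∷ P) , (_ ∷ Q) , (_ ∷ R) , refl) free =
    uncurry (opposite-copies-unbalanced P Q R) (T-forced k P Q R free)

proposition8 : ∀ (k : ℕ) → ¬ WeakBisection 4 (T k)
proposition8 k W = T-unbalanced k V₁ (weakBisection⇒cherryFree (T k) W)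
  (trans balanced (cong ∣_∣ (V₂≡∁V₁ bisection)))
  where open WeakBisection W
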